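{- Let $m\in\mathbb{Z}$ and $n=|4m-1|$. Then $$\sum_{k=0}^{n-1}\binom{2k}{k}m^k\equiv0\pmod n.$$ -}

module Defs where

open import Data.Integer using (ℤ; +_; _-_)
open import Data.Integer.Divisibility.Signed using (_∣_)
open import Data.Integer.Properties using (+-0-commutativeMonoid)
open import Data.Nat using (ℕ)

open import Algebra.Properties.CommutativeMonoid.Sum +-0-commutativeMonoid public
  using (sum; sum-syntax)

infix 4 _≡_[mod_]

_≡_[mod_] : ℤ → ℤ → ℕ → Set
x ≡ y [mod n ] = + n ∣ x - y

{-# OPTIONS --safe #-}

-- Put d = 4m - 1.  The classical identity Σ_{k<N} C(2k,k)/4^k = 2N C(2N,N)/4^N becomes, with m ≡ 1/4,
-- the congruence Σ_{k<N} C(2k,k) m^k ≡ 2N C(2N,N) m^N (mod d), which an induction on N proves without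
-- inverting 4: the step is (N+1) C(2N+2,N+1) = 2(2N+1) C(2N,N).  At N = |d| the right side vanishes.

module Submission where

open import Data.Fin using (fromℕ; inject₁; toℕ)
open import Data.Fin.Properties using (toℕ-fromℕ; toℕ-inject₁)
open import Data.Integer using (ℤ; +_; _-_; _+_; _*_; _^_; ∣_∣)
open import Data.Integer.Divisibility.Signed
  using (_∣_; divides; ∣-trans; ∣-refl; ∣m∣n⇒∣m+n; ∣m∣n⇒∣m-n; ∣n⇒∣m*n; ∣m⇒∣m*n; ∣m∣∣m)
open import Data.Integer.Properties using (pos-*; +-0-commutativeMonoid)
open import Data.Integer.Tactic.RingSolver using (solve-∀)
open import Data.Nat as ℕ using (ℕ; zero; suc)
open import Data.Nat.Combinatorics using (_C_; nC1≡n; nCk≡nC[n∸k]; nCk+nC[k+1]≡[n+1]C[k+1])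
import Data.Nat.Properties as ℕ
import Data.Nat.Tactic.RingSolver as ℕ-Solver
open import Relation.Binary.PropositionalEquality
  using (_≡_; refl; sym; cong; cong₂; subst; module ≡-Reasoning)
open import Algebra.Properties.CommutativeMonoid.Sum +-0-commutativeMonoid
  using (sum-cong-≗; sum-init-last)
open import Defs

open ≡-Reasoning

-- The absorption identity. Pascal's rule reduces it to row `n`, at `k` and `suc k`, and a second
-- use of the rule reassembles the two results.
[1+k]*[1+n]C[1+k]≡[1+n]*nCk : ∀ n k → suc k ℕ.* (suc n C suc k) ≡ suc n ℕ.* (n C k)
[1+k]*[1+n]C[1+k]≡[1+n]*nCk n zero = begin
  1 ℕ.* (suc n C 1)    ≡⟨ ℕ.*-identityˡ _ ⟩
  suc n C 1            ≡⟨ nC1≡n (suc n) ⟩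
  suc n                ≡⟨ ℕ.*-identityʳ (suc n) ⟨
  suc n ℕ.* (n C 0)    ∎
-- Both binomials lie outside the triangle and compute to 0.
[1+k]*[1+n]C[1+k]≡[1+n]*nCk zero (suc k) = ℕ.*-zeroʳ (suc (suc k))
[1+k]*[1+n]C[1+k]≡[1+n]*nCk (suc n) (suc k) = begin
  suc (suc k) ℕ.* (suc (suc n) C suc (suc k))
    ≡⟨ cong (suc (suc k) ℕ.*_) (nCk+nC[k+1]≡[n+1]C[k+1] (suc n) (suc k)) ⟨
  suc (suc k) ℕ.* (a ℕ.+ b)
    -- One copy of `a` is set aside: the induction hypothesis needs the coefficient `suc k` on `a`,
    -- and the spare copy later raises `suc n` to `suc (suc n)`.
    ≡⟨ expand k a b ⟩
  a ℕ.+ (suc k ℕ.* a ℕ.+ suc (suc k) ℕ.* b)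
    ≡⟨ cong (a ℕ.+_) (cong₂ ℕ._+_ ([1+k]*[1+n]C[1+k]≡[1+n]*nCk n k) ([1+k]*[1+n]C[1+k]≡[1+n]*nCk n (suc k))) ⟩
  a ℕ.+ (suc n ℕ.* (n C k) ℕ.+ suc n ℕ.* (n C suc k))
    ≡⟨ cong (a ℕ.+_) (ℕ.*-distribˡ-+ (suc n) (n C k) (n C suc k)) ⟨
  a ℕ.+ suc n ℕ.* (n C k ℕ.+ n C suc k)
    ≡⟨ cong (λ x → a ℕ.+ suc n ℕ.* x) (nCk+nC[k+1]≡[n+1]C[k+1] n k) ⟩
  suc (suc n) ℕ.* a
    ∎
  where
  a = suc n C suc k
  b = suc n C suc (suc k)
  expand : ∀ k a b → suc (suc k) ℕ.* (a ℕ.+ b) ≡ a ℕ.+ (suc k ℕ.* a ℕ.+ suc (suc k) ℕ.* b)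
  expand = ℕ-Solver.solve-∀

-- Pascal's rule splits the central coefficient into the two middle entries of row 2n+1. These agree
-- by symmetry, which gives the factor 2, and absorption lowers the row to 2n.
centralBinomial-suc : ∀ n → suc n ℕ.* ((2 ℕ.* suc n) C suc n) ≡ 2 ℕ.* (suc (2 ℕ.* n) ℕ.* ((2 ℕ.* n) C n))
centralBinomial-suc n = begin
  suc n ℕ.* ((2 ℕ.* suc n) C suc n)
    ≡⟨ cong (λ x → suc n ℕ.* (x C suc n)) (ℕ.*-suc 2 n) ⟩
  suc n ℕ.* (suc (suc (2 ℕ.* n)) C suc n)
    ≡⟨ cong (suc n ℕ.*_) (nCk+nC[k+1]≡[n+1]C[k+1] (suc (2 ℕ.* n)) n) ⟨
  suc n ℕ.* (suc (2 ℕ.* n) C n ℕ.+ c)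
    ≡⟨ cong (λ x → suc n ℕ.* (x ℕ.+ c)) symmetry ⟩
  suc n ℕ.* (c ℕ.+ c)
    ≡⟨ double (suc n) c ⟩
  2 ℕ.* (suc n ℕ.* c)
    ≡⟨ cong (2 ℕ.*_) ([1+k]*[1+n]C[1+k]≡[1+n]*nCk (2 ℕ.* n) n) ⟩
  2 ℕ.* (suc (2 ℕ.* n) ℕ.* ((2 ℕ.* n) C n))
    ∎
  where
  c = suc (2 ℕ.* n) C suc n
  double : ∀ x y → x ℕ.* (y ℕ.+ y) ≡ 2 ℕ.* (x ℕ.* y)
  double = ℕ-Solver.solve-∀
  1+2n≡[1+n]+n : ∀ n → suc (2 ℕ.* n) ≡ suc n ℕ.+ n
  1+2n≡[1+n]+n = ℕ-Solver.solve-∀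
  symmetry : suc (2 ℕ.* n) C n ≡ c
  symmetry = begin
    suc (2 ℕ.* n) C n                      ≡⟨ nCk≡nC[n∸k] (ℕ.≤-trans (ℕ.m≤n*m n 2) (ℕ.n≤1+n _)) ⟩
    suc (2 ℕ.* n) C (suc (2 ℕ.* n) ℕ.∸ n)  ≡⟨ cong (λ x → suc (2 ℕ.* n) C (x ℕ.∸ n)) (1+2n≡[1+n]+n n) ⟩
    suc (2 ℕ.* n) C (suc n ℕ.+ n ℕ.∸ n)    ≡⟨ cong (suc (2 ℕ.* n) C_) (ℕ.m+n∸n≡m (suc n) n) ⟩
    c                                      ∎

-- Sums over `Fin` unfold at the first index, while induction on the upper limit needs the last one.
sum-toℕ-suc : ∀ (f : ℕ → ℤ) n → ∑[ k < suc n ] f (toℕ k) ≡ ∑[ k < n ] f (toℕ k) + f n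
sum-toℕ-suc f n = begin
  ∑[ k < suc n ] f (toℕ k)
    ≡⟨ sum-init-last {n} (λ k → f (toℕ k)) ⟩
  ∑[ k < n ] f (toℕ (inject₁ k)) + f (toℕ (fromℕ n))
    ≡⟨ cong₂ _+_ (sum-cong-≗ {n} (λ k → cong f (toℕ-inject₁ k))) (cong f (toℕ-fromℕ n)) ⟩
  ∑[ k < n ] f (toℕ k) + f n
    ∎

module _ (m : ℤ) where

  term : ℕ → ℤ
  term k = + ((2 ℕ.* k) C k) * m ^ k

  -- The recurrence gives 2(n+1) `term (n+1)` = 4m(2n+1) `term n`, so the difference grows by
  -- exactly (4m-1)(2n+1) `term n` at each step.
  4m-1∣2n*term-sum : ∀ n → + 4 * m - + 1 ∣ + 2 * (+ n * term n) - ∑[ k < n ] term (toℕ k)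
  4m-1∣2n*term-sum zero = divides (+ 0) refl
  4m-1∣2n*term-sum (suc n) =
    subst (+ 4 * m - + 1 ∣_) (sym step)
      (∣m∣n⇒∣m+n (4m-1∣2n*term-sum n) (∣n⇒∣m*n ((+ 1 + + 2 * + n) * term n) (∣-refl)))
    where
    s = ∑[ k < n ] term (toℕ k)
    c = + ((2 ℕ.* n) C n)
    c′ = + ((2 ℕ.* suc n) C suc n)

    recurrence : + suc n * c′ ≡ + 2 * ((+ 1 + + 2 * + n) * c)
    recurrence = begin
      + suc n * c′
        ≡⟨ pos-* (suc n) _ ⟨
      + (suc n ℕ.* ((2 ℕ.* suc n) C suc n))
        ≡⟨ cong +_ (centralBinomial-suc n) ⟩
      + (2 ℕ.* (suc (2 ℕ.* n) ℕ.* ((2 ℕ.* n) C n)))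
        ≡⟨ pos-* 2 (suc (2 ℕ.* n) ℕ.* ((2 ℕ.* n) C n)) ⟩
      + 2 * + (suc (2 ℕ.* n) ℕ.* ((2 ℕ.* n) C n))
        ≡⟨ cong (+ 2 *_) (pos-* (suc (2 ℕ.* n)) _) ⟩
      -- The successor becomes `+ 1 +` by computation alone.
      + 2 * ((+ 1 + + (2 ℕ.* n)) * c)
        ≡⟨ cong (λ x → + 2 * ((+ 1 + x) * c)) (pos-* 2 n) ⟩
      + 2 * ((+ 1 + + 2 * + n) * c)
        ∎

    regroup : ∀ a b m p t → + 2 * (a * (b * (m * p))) - t ≡ + 2 * ((a * b) * (m * p)) - t
    regroup = solve-∀

    collect : ∀ m x c p s →
      + 2 * ((+ 2 * ((+ 1 + + 2 * x) * c)) * (m * p)) - (s + c * p) ≡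
      (+ 2 * (x * (c * p)) - s) + ((+ 1 + + 2 * x) * (c * p)) * (+ 4 * m - + 1)
    collect = solve-∀

    step : + 2 * (+ suc n * term (suc n)) - ∑[ k < suc n ] term (toℕ k) ≡
           (+ 2 * (+ n * term n) - s) + ((+ 1 + + 2 * + n) * term n) * (+ 4 * m - + 1)
    step = begin
      + 2 * (+ suc n * term (suc n)) - ∑[ k < suc n ] term (toℕ k)
        ≡⟨ cong (λ x → + 2 * (+ suc n * term (suc n)) - x) (sum-toℕ-suc term n) ⟩
      + 2 * (+ suc n * (c′ * (m * m ^ n))) - (s + term n)
        ≡⟨ regroup (+ suc n) c′ m (m ^ n) (s + term n) ⟩
      + 2 * ((+ suc n * c′) * (m * m ^ n)) - (s + term n)
        ≡⟨ cong (λ x → + 2 * (x * (m * m ^ n)) - (s + term n)) recurrence ⟩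
      + 2 * ((+ 2 * ((+ 1 + + 2 * + n) * c)) * (m * m ^ n)) - (s + term n)
        ≡⟨ collect m (+ n) c (m ^ n) s ⟩
      (+ 2 * (+ n * term n) - s) + ((+ 1 + + 2 * + n) * term n) * (+ 4 * m - + 1)
        ∎

corollary1p2 : ∀ (m : ℤ) (n : ℕ) → n ≡ ∣ + 4 * m - + 1 ∣ → (∑[ k < n ] (+ ((2 ℕ.* toℕ k) C toℕ k) * m ^ toℕ k)) ≡ + 0 [mod n ]
corollary1p2 m n n≡∣4m-1∣ = subst (+ n ∣_) (cancel (+ 2 * (+ n * term m n)) _)
  (∣m∣n⇒∣m-n (∣n⇒∣m*n (+ 2) (∣m⇒∣m*n (term m n) (∣-refl)))
             (∣-trans n∣4m-1 (4m-1∣2n*term-sum m n)))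
  where
  n∣4m-1 : + n ∣ + 4 * m - + 1
  n∣4m-1 = subst (λ x → + x ∣ + 4 * m - + 1) (sym n≡∣4m-1∣) ∣m∣∣m
  cancel : ∀ x s → x - (x - s) ≡ s - + 0
  cancel = solve-∀
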